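{- For every $n\ge 1$, $\mathbb{E}_n[U_n]=H_n=\sum_{j=1}^n \frac1j$; that is, the expected number of unrestricted rows of a uniformly random type-B permutation tableau of size $n$ is the $n$-th harmonic number.
   Context: A Ferrers diagram is a left-justified array of cells whose row lengths weakly decrease from top to bottom (rows of length $0$ are allowed). Its half-perimeter is the number of rows plus the number of columns. If the diagram has $c$ columns, the shifted Ferrers diagram is obtained by inserting $c$ new left-justified rows above it, of lengths $c,c-1,\dots,1$ from top to bottom; the rightmost cell of each inserted row is a diagonal cell. A type-B permutation tableau of size $n$ is a filling of a shifted Ferrers diagram of half-perimeter $n$ with $0$'s and $1$'s such that: (1) every column contains at least one $1$; (2) no $0$ has both a $1$ above it in its column and a $1$ to its left in its row; (3) if a diagonal cell contains $0$ then every cell of its row contains $0$. Let $\mathcal{B}_n$ be the set of such tableaux, $\mathbb{P}_n$ the uniform probability measure on $\mathcal{B}_n$, $\mathbb{E}_n$ its expectation. A restricted $0$ is a cell containing $0$ that either has a $1$ above it in its column or is a diagonal cell. A row of the shifted diagram (possibly of length $0$) is unrestricted if it contains no restricted $0$. For $T\in\mathcal{B}_n$, $U_n(T)$ is the number of unrestricted rows of $T$.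
   Formalization: The inserted rows are taken with lengths 1, 2, …, c from top to bottom, not c, …, 1: with the order as written the mean at n = 2 is 13/8, not 3/2. Columns of length 0 in the Ferrers diagram are allowed, as rows of length 0 are. -}

module Defs where

open import Data.Bool using (Bool; true; false)
import Data.Bool.Properties as Bool
open import Data.Integer using (+_)
open import Data.List using (List; []; _∷_; [_]; _++_; length; map; foldr; filter;
  replicate; upTo; concatMap; cartesianProductWith; deduplicate)
open import Data.List.Properties using (≡-dec; length-replicate)
open import Data.List.Membership.Propositional using (_∈_; lose)
open import Data.List.Membership.Propositional.Properties using
  (∈-map⁺; ∈-concatMap⁺; ∈-cartesianProductWith⁺; ∈-filter⁺; ∈-filter⁻; ∈-upTo⁺; ∈-deduplicate⁺; ∈-deduplicate⁻)
open import Data.List.Relation.Unary.All using (All; []; _∷_; all?)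
open import Data.List.Relation.Unary.Any using (here; there)
open import Data.List.Relation.Unary.Linked using (Linked; []; [-]; _∷_; linked?)
open import Data.List.Relation.Unary.Unique.Propositional using (Unique)
open import Data.List.Relation.Unary.Unique.DecPropositional.Properties using (deduplicate-!)
open import Data.Maybe using (Maybe; just; nothing; _>>=_)
import Data.Maybe.Properties as Maybe
open import Data.Nat using (ℕ; zero; suc; _+_; _∸_; _≤_; _<_; _≥_; z≤n; s≤s; NonZero; _≟_; _≤?_; _<?_; _≥?_)
open import Data.Nat.Properties using (allUpTo?; anyUpTo?; m≤n+m; m+n∸n≡m; +-identityʳ)
open import Data.Product using (∃; _×_; _,_; proj₂)
open import Data.Rational as ℚ using (ℚ; 0ℚ; _/_)
open import Function using (_⇔_; mk⇔; Equivalence)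
open import Relation.Binary using (DecidableEquality)
open import Relation.Binary.PropositionalEquality using (_≡_; refl; sym; trans; cong; subst)
open import Relation.Nullary using (¬_; Dec; yes; no)
open import Relation.Nullary.Decidable using (map′; ¬?; _×-dec_; _→-dec_; _⊎-dec_)
open import Data.Sum using (_⊎_)

infixl 9 _‼_

_‼_ : {A : Set} → List A → ℕ → Maybe A
[]       ‼ _     = nothing
(x ∷ _)  ‼ zero  = just x
(_ ∷ xs) ‼ suc i = xs ‼ i

-- The number of columns is data rather than the first row length: rows and
-- columns of length 0 both occur and both count towards the half-perimeter.
record IsFerrers (columns : ℕ) (rowLengths : List ℕ) : Set where
  constructor isFerrers
  field
    decreasing : Linked _≥_ rowLengths
    fits       : All (_≤ columns) rowLengths

-- The inserted rows have lengths 1, 2, …, c from top to bottom: rows of lengths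
-- c, c-1, …, 1 are put above the diagram one after the other, the last on top.
-- In the opposite vertical order the sets below would not have 2ⁿ n! elements,
-- and the mean number of unrestricted rows would be 13/8 instead of 3/2 at n = 2.
shiftedLengths : ℕ → List ℕ → List ℕ
shiftedLengths c rowLengths = map suc (upTo c) ++ rowLengths

record Filling : Set where
  constructor mkFilling
  field
    columns    : ℕ
    rowLengths : List ℕ           -- of the Ferrers diagram, before shifting
    content    : List (List Bool) -- rows of the shifted diagram, top to bottom

  shiftedRows : ℕ
  shiftedRows = columns + length rowLengths

  -- Rows and columns are numbered from 0, from the top and from the left.
  entry : ℕ → ℕ → Maybe Bool
  entry i j = (content ‼ i) >>= (_‼ j)

  One Zero : ℕ → ℕ → Set
  One  i j = entry i j ≡ just true
  Zero i j = entry i j ≡ just false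

  Diagonal : ℕ → ℕ → Set
  Diagonal i j = i < columns × shiftedLengths columns rowLengths ‼ i ≡ just (suc j)

  OneAbove OneLeft : ℕ → ℕ → Set
  OneAbove i j = ∃ λ i′ → i′ < i × One i′ j
  OneLeft  i j = ∃ λ j′ → j′ < j × One i j′

  RestrictedZero : ℕ → ℕ → Set
  RestrictedZero i j = Zero i j × (OneAbove i j ⊎ Diagonal i j)

  Unrestricted : ℕ → Set
  Unrestricted i = ¬ (∃ λ j → j < columns × RestrictedZero i j)

  one? : ∀ i j → Dec (One i j)
  one? i j = Maybe.≡-dec Bool._≟_ (entry i j) (just true)

  zero? : ∀ i j → Dec (Zero i j)
  zero? i j = Maybe.≡-dec Bool._≟_ (entry i j) (just false)

  diagonal? : ∀ i j → Dec (Diagonal i j)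
  diagonal? i j = (i <? columns) ×-dec
                  Maybe.≡-dec _≟_ (shiftedLengths columns rowLengths ‼ i) (just (suc j))

  oneAbove? : ∀ i j → Dec (OneAbove i j)
  oneAbove? i j = anyUpTo? (λ i′ → one? i′ j) i

  oneLeft? : ∀ i j → Dec (OneLeft i j)
  oneLeft? i j = anyUpTo? (λ j′ → one? i j′) j

  unrestricted? : ∀ i → Dec (Unrestricted i)
  unrestricted? i =
    ¬? (anyUpTo? (λ j → zero? i j ×-dec (oneAbove? i j ⊎-dec diagonal? i j)) columns)

record IsTableau (n : ℕ) (T : Filling) : Set where
  constructor isTableau
  open Filling T
  field
    ferrers       : IsFerrers columns rowLengths
    halfPerimeter : length rowLengths + columns ≡ n
    fills         : map length content ≡ shiftedLengths columns rowLengths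
    columnHasOne  : ∀ j → j < columns → ∃ λ i → i < shiftedRows × One i j
    noBadZero     : ∀ i → i < shiftedRows → ∀ j → j < columns →
                    Zero i j → ¬ (OneAbove i j × OneLeft i j)
    diagonalZero  : ∀ i → i < shiftedRows → ∀ j → j < columns →
                    Diagonal i j → Zero i j →
                    ∀ j′ → j′ < columns → ¬ One i j′

U : Filling → ℕ
U T = length (filter unrestricted? (upTo shiftedRows))
  where open Filling T

isFerrers? : ∀ c ls → Dec (IsFerrers c ls)
isFerrers? c ls = map′ (λ (d , f) → isFerrers d f) (λ (isFerrers d f) → d , f)
                       (linked? _≥?_ ls ×-dec all? (_≤? c) ls)

allBelow? : {P : ℕ → Set} → (∀ i → Dec (P i)) → ∀ v → Dec (∀ i → i < v → P i)
allBelow? P? v = map′ (λ f i → f {i}) (λ f {i} → f i) (allUpTo? P? v)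

isTableau? : ∀ n T → Dec (IsTableau n T)
isTableau? n T =
  map′ (λ (a , b , c , d , e , f) → isTableau a b c d e f)
       (λ (isTableau a b c d e f) → a , b , c , d , e , f)
  ( isFerrers? columns rowLengths
  ×-dec (length rowLengths + columns ≟ n)
  ×-dec ≡-dec _≟_ (map length content) (shiftedLengths columns rowLengths)
  ×-dec allBelow? (λ j → anyUpTo? (λ i → one? i j) shiftedRows) columns
  ×-dec allBelow? (λ i → allBelow? (λ j →
          zero? i j →-dec ¬? (oneAbove? i j ×-dec oneLeft? i j)) columns) shiftedRows
  ×-dec allBelow? (λ i → allBelow? (λ j →
          diagonal? i j →-dec (zero? i j →-dec
          allBelow? (λ j′ → ¬? (one? i j′)) columns)) columns) shiftedRows )
  where open Filling T

_≟ᶠ_ : DecidableEquality Filling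
mkFilling c ls xs ≟ᶠ mkFilling c′ ls′ xs′ =
  map′ (λ { (refl , refl , refl) → refl }) (λ { refl → refl , refl , refl })
       (c ≟ c′ ×-dec ≡-dec _≟_ ls ls′ ×-dec ≡-dec (≡-dec Bool._≟_) xs xs′)

words : {A : Set} → List A → ℕ → List (List A)
words as zero    = [ [] ]
words as (suc n) = cartesianProductWith _∷_ as (words as n)

raggedArrays : {A : Set} → List A → List ℕ → List (List (List A))
raggedArrays as []       = [ [] ]
raggedArrays as (l ∷ ls) = cartesianProductWith _∷_ (words as l) (raggedArrays as ls)

-- A finite list containing every tableau of size n (and other fillings).
candidates : ℕ → List Filling
candidates n =
  concatMap (λ c →
    concatMap (λ ls →
      map (mkFilling c ls) (raggedArrays (true ∷ false ∷ []) (shiftedLengths c ls)))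
    (words (upTo (suc c)) (n ∸ c)))
  (upTo (suc n))

𝓑 : ℕ → List Filling
𝓑 n = deduplicate _≟ᶠ_ (filter (isTableau? n) (candidates n))

𝓑-unique : ∀ n → Unique (𝓑 n)
𝓑-unique n = deduplicate-! _≟ᶠ_ (filter (isTableau? n) (candidates n))

∈-words : {A : Set} {as : List A} {xs : List A} → All (_∈ as) xs → xs ∈ words as (length xs)
∈-words []         = here refl
∈-words (px ∷ pxs) = ∈-cartesianProductWith⁺ _∷_ px (∈-words pxs)

∈-raggedArrays : {A : Set} {as : List A} → (∀ a → a ∈ as) →
                 (xss : List (List A)) → xss ∈ raggedArrays as (map length xss)
∈-raggedArrays all∈ []         = here refl
∈-raggedArrays {as = as} all∈ (xs ∷ xss) =
  ∈-cartesianProductWith⁺ _∷_ (∈-words (every xs)) (∈-raggedArrays all∈ xss)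
  where
  every : ∀ ys → All (_∈ as) ys
  every []       = []
  every (y ∷ ys) = all∈ y ∷ every ys

∈-candidates : ∀ {n T} → IsTableau n T → T ∈ candidates n
∈-candidates {T = mkFilling c ls xss} (isTableau (isFerrers _ fits) refl fills _ _ _) =
  ∈-concatMap⁺ _ (lose (∈-upTo⁺ (s≤s (m≤n+m c (length ls))))
    (∈-concatMap⁺ _ (lose ls∈
      (∈-map⁺ (mkFilling c ls)
        (subst (λ ks → xss ∈ raggedArrays _ ks) fills (∈-raggedArrays bool xss))))))
  where
  bool : ∀ b → b ∈ true ∷ false ∷ []
  bool true  = here refl
  bool false = there (here refl)

  bounded : ∀ {ks} → All (_≤ c) ks → All (_∈ upTo (suc c)) ks
  bounded []       = []
  bounded (p ∷ ps) = ∈-upTo⁺ (s≤s p) ∷ bounded ps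

  ls∈ : ls ∈ words (upTo (suc c)) (length ls + c ∸ c)
  ls∈ = subst (λ k → ls ∈ words (upTo (suc c)) k) (sym (m+n∸n≡m (length ls) c))
              (∈-words (bounded fits))

∈-𝓑 : ∀ {n T} → T ∈ 𝓑 n ⇔ IsTableau n T
∈-𝓑 {n} = mk⇔
  (λ T∈ → proj₂ (∈-filter⁻ (isTableau? n) {xs = candidates n}
                   (∈-deduplicate⁻ _≟ᶠ_ _ T∈)))
  (λ t → ∈-deduplicate⁺ _≟ᶠ_ (∈-filter⁺ (isTableau? n) (∈-candidates t) t))

emptyTableau : ∀ n → IsTableau n (mkFilling 0 (replicate n 0) (replicate n []))
emptyTableau n = isTableau (isFerrers (decreasing n) (fits n))
  (trans (+-identityʳ _) (length-replicate n)) (lengths n) (λ _ ()) (λ _ _ _ ()) (λ _ _ _ ())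
  where
  decreasing : ∀ k → Linked _≥_ (replicate k 0)
  decreasing zero          = []
  decreasing (suc zero)    = [-]
  decreasing (suc (suc k)) = z≤n ∷ decreasing (suc k)

  fits : ∀ k → All (_≤ 0) (replicate k 0)
  fits zero    = []
  fits (suc k) = z≤n ∷ fits k

  lengths : ∀ k → map length (replicate k ([] {A = Bool})) ≡ replicate k 0
  lengths zero    = refl
  lengths (suc k) = cong (0 ∷_) (lengths k)

∈⇒nonZero : {A : Set} {x : A} {xs : List A} → x ∈ xs → NonZero (length xs)
∈⇒nonZero (here _)  = _
∈⇒nonZero (there _) = _

𝓑-nonZero : ∀ n → NonZero (length (𝓑 n))
𝓑-nonZero n = ∈⇒nonZero (Equivalence.from (∈-𝓑 {n}) (emptyTableau n))

sumℚ : List ℚ → ℚ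
sumℚ = foldr ℚ._+_ 0ℚ

-- Mass given by the uniform probability measure to each single tableau of size n.
ℙ : ℕ → ℚ
ℙ n = (+ 1 / length (𝓑 n)) {{𝓑-nonZero n}}

𝔼 : ℕ → (Filling → ℚ) → ℚ
𝔼 n X = sumℚ (map (λ T → X T ℚ.* ℙ n) (𝓑 n))

ℕ→ℚ : ℕ → ℚ
ℕ→ℚ k = + k / 1

H : ℕ → ℚ
H n = sumℚ (map (λ k → + 1 / suc k) (upTo n))

{-# OPTIONS --safe #-}
module Submission where

-- A tableau of size n + 1 arises in exactly one way from one of size n, by adding
-- either an empty row at the bottom or a column on the left, whose new top row is
-- the single diagonal cell. By rules (2) and (3) the new column is 0 in the
-- restricted rows; in the u unrestricted ones it is arbitrary, except that the
-- column contains a 1. Its 0's below a 1 become restricted, so the extensions of a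
-- tableau with u unrestricted rows have generating function
--   x·xᵘ + x(1 + x)ᵘ + (x(1 + x)ᵘ − x·xᵘ) = 2x(1 + x)ᵘ.
-- Hence B_{n+1}(x) = 2x Bₙ(x + 1), that is Bₙ(x) = 2ⁿ x(x + 1)⋯(x + n − 1), and the
-- mean of U is the logarithmic derivative of Bₙ at 1.

open import Defs
open import Data.Bool using (Bool; true; false; if_then_else_; _∧_; _∨_; not)
open import Data.Bool.Properties using (∨-zeroʳ; ⇔→≡)
import Data.Integer as ℤ
import Data.Integer.Properties as ℤ
open import Data.List using (List; []; _∷_; _++_; _∷ʳ_; length; map; filter; concatMap; zipWith; applyUpTo; upTo)
open import Data.List.Properties using (length-++; length-map; length-applyUpTo;
  map-++; map-applyUpTo; map-∘; ++-assoc; ∷-injective; ∷-injectiveˡ; ∷-injectiveʳ;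
  ∷ʳ-injectiveˡ; map-injective)
open import Data.List.Membership.Propositional using (_∈_; lose; find)
open import Data.List.Membership.Propositional.Properties using
  (∈-map⁺; ∈-map⁻; ∈-++⁺ˡ; ∈-++⁺ʳ; ∈-++⁻; ∈-concatMap⁺; ∈-concatMap⁻)
open import Data.List.Membership.Propositional.Properties.WithK using (unique∧set⇒bag)
open import Data.List.Relation.Binary.BagAndSetEquality using (∼bag⇒↭)
open import Data.List.Relation.Binary.Permutation.Propositional using (_↭_)
import Data.List.Relation.Binary.Permutation.Propositional.Properties as Perm
open import Data.List.Relation.Unary.All as All using (All; []; _∷_)
import Data.List.Relation.Unary.All.Properties as All
open import Data.List.Relation.Unary.AllPairs as AllPairs using ([]; _∷_)
import Data.List.Relation.Unary.AllPairs.Properties as AllPairs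
open import Data.List.Relation.Unary.Any using (here; there)
open import Data.List.Relation.Unary.Linked as Linked using (Linked; []; [-]; _∷_)
import Data.List.Relation.Unary.Linked.Properties as Linked
open import Data.List.Relation.Unary.Unique.Propositional using (Unique)
open import Data.List.Relation.Unary.Unique.Propositional.Properties using (map⁺; ++⁺; concat⁺)
open import Data.Maybe using (Maybe; just; nothing; _>>=_)
open import Data.Maybe.Properties using (just-injective)
open import Data.Nat using (ℕ; zero; suc; _+_; _*_; _^_; _≤_; _<_; _≥_; z≤n; s≤s; NonZero)
open import Data.Nat.ListAction using (sum)
open import Data.Nat.ListAction.Properties using (sum-↭; sum-++)
open import Data.Nat.Properties
open import Data.Nat.Tactic.RingSolver using (solve-∀)
open import Data.Product using (∃; ∃₂; _×_; _,_; proj₁; proj₂; uncurry)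
open import Data.Rational as ℚ using (ℚ; 0ℚ; 1ℚ; _/_; toℚᵘ)
import Data.Rational.Properties as ℚ
open import Data.Rational.Solver using (module +-*-Solver)
open import Data.Rational.Unnormalised as ℚᵘ using (mkℚᵘ; *≡*)
import Data.Rational.Unnormalised.Properties as ℚᵘ
open import Data.Sum as Sum using (_⊎_; inj₁; inj₂; [_,_]′)
open import Function using (_∘_; id; _⇔_; mk⇔; Equivalence)
open import Function.Construct.Composition using (_⇔-∘_)
open import Function.Properties.Equivalence using () renaming (sym to ⇔-sym)
open import Relation.Binary.PropositionalEquality
open import Relation.Nullary using (¬_; Dec; yes; no; does; contradiction)

open Equivalence using (to; from)

-- Lists

-- Polynomials are replaced by weights. For an arbitrary `f : ℕ → ℕ` the sum of `f (U T)` over size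
-- n + 1 is expressed by a sum over size n of a binomial transform of `f`. The weights u ↦ xᵘ and u
-- ↦ u xᵘ⁻¹ then give Bₙ(x) and Bₙ′(x) at natural x, without differentiating anything. Only x = 1
-- matters in the end, but the recurrence moves x to x + 1, so x stays arbitrary. The obstacle is
-- that `𝓑` is a filtered enumeration with no recursive structure. Its lists are known only through
-- their members, so the passage from n to n + 1 has to be a genuine bijection: every step must be
-- legal, reversible and counted once. To keep that manageable, the conditions on row lengths are
-- separated from the rules on 0's and 1's, and the latter are stated for functions of two indices,
-- on which adding a column is a mere shift of both indices.

module _ {A B : Set} {f : A → B} where

  -- Injectivity is asked only on members of the list because `grow` is shown injective only on
  -- legal steps of tableaux.
  map-unique : ∀ {xs} → (∀ {x y} → x ∈ xs → y ∈ xs → f x ≡ f y → x ≡ y) →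
               Unique xs → Unique (map f xs)
  map-unique inj []       = []
  map-unique inj (x∉ ∷ u) =
    All.map⁺ (All.tabulate λ y∈ eq → All.lookup x∉ y∈ (inj (here refl) (there y∈) eq)) ∷
    map-unique (λ p q → inj (there p) (there q)) u

module _ {A B : Set} (g : A → List B) where

  pairs : List A → List (A × B)
  pairs = concatMap (λ x → map (x ,_) (g x))

  pairs-unique : (∀ x → Unique (g x)) → ∀ {xs} → Unique xs → Unique (pairs xs)
  pairs-unique g! {xs} xs! = concat⁺
    (All.map⁺ (All.universal (λ x → map⁺ (cong proj₂) (g! x)) xs))
    (AllPairs.map⁺ (AllPairs.map (λ x≢y {_} (p , q) → x≢y (same p q)) xs!))
    where
    same : ∀ {x y z} → z ∈ map (x ,_) (g x) → z ∈ map (y ,_) (g y) → x ≡ y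
    same p q with _ , _ , refl ← ∈-map⁻ _ p | _ , _ , refl ← ∈-map⁻ _ q = refl

  ∈-pairs⁺ : ∀ {x y xs} → x ∈ xs → y ∈ g x → (x , y) ∈ pairs xs
  ∈-pairs⁺ x∈ y∈ = ∈-concatMap⁺ _ (lose x∈ (∈-map⁺ _ y∈))

  ∈-pairs⁻ : ∀ {x y xs} → (x , y) ∈ pairs xs → x ∈ xs × y ∈ g x
  ∈-pairs⁻ {xs = xs} p with _ , x∈ , q ← find (∈-concatMap⁻ _ {xs = xs} p)
                       with _ , y∈ , refl ← ∈-map⁻ _ q = x∈ , y∈

  sum-pairs : ∀ (h : A × B → ℕ) xs →
              sum (map h (pairs xs)) ≡ sum (map (λ x → sum (map (λ y → h (x , y)) (g x))) xs)
  sum-pairs h []       = refl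
  sum-pairs h (x ∷ xs) = begin
    sum (map h (map (x ,_) (g x) ++ pairs xs))                ≡⟨ cong sum (map-++ h (map (x ,_) (g x)) _) ⟩
    sum (map h (map (x ,_) (g x)) ++ map h (pairs xs))        ≡⟨ sum-++ (map h (map (x ,_) (g x))) _ ⟩
    sum (map h (map (x ,_) (g x))) + sum (map h (pairs xs))   ≡⟨ cong₂ _+_ (cong sum (sym (map-∘ (g x)))) (sum-pairs h xs) ⟩
    _ ∎
    where open ≡-Reasoning

sum-map-cong : {A : Set} {f g : A → ℕ} {xs : List A} → (∀ {x} → x ∈ xs → f x ≡ g x) →
               sum (map f xs) ≡ sum (map g xs)
sum-map-cong {xs = []}     eq = refl
sum-map-cong {xs = x ∷ xs} eq = cong₂ _+_ (eq (here refl)) (sum-map-cong (eq ∘ there))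

‼-bound : {A : Set} (xs : List A) → ∀ {i x} → xs ‼ i ≡ just x → i < length xs
‼-bound (x ∷ xs) {zero}  eq = s≤s z≤n
‼-bound (x ∷ xs) {suc i} eq = s≤s (‼-bound xs eq)

‼-∈ : {A : Set} (xs : List A) → ∀ {i x} → xs ‼ i ≡ just x → x ∈ xs
‼-∈ (x ∷ xs) {zero}  refl = here refl
‼-∈ (x ∷ xs) {suc i} eq   = there (‼-∈ xs eq)

‼-applyUpTo : {A : Set} (f : ℕ → A) → ∀ ys {i n} → i < n → (applyUpTo f n ++ ys) ‼ i ≡ just (f i)
‼-applyUpTo f ys {zero}  {suc n} lt       = refl
‼-applyUpTo f ys {suc i} {suc n} (s≤s lt) = ‼-applyUpTo (f ∘ suc) ys lt

-- Fillings of a new leftmost column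

count : (ℕ → Bool) → ℕ → ℕ
count u zero    = 0
count u (suc m) = if u 0 then suc (count (u ∘ suc) m) else count (u ∘ suc) m

count-cong : ∀ {u v} m → (∀ i → i < m → u i ≡ v i) → count u m ≡ count v m
count-cong zero    eq = refl
count-cong (suc m) eq rewrite eq 0 (s≤s z≤n) | count-cong m (λ i lt → eq (suc i) (s≤s lt)) = refl

count-snoc : ∀ u m → u m ≡ true → count u (suc m) ≡ suc (count u m)
count-snoc u zero    eq rewrite eq = refl
count-snoc u (suc m) eq with u 0
... | true  = cong suc (count-snoc (u ∘ suc) m eq)
... | false = count-snoc (u ∘ suc) m eq

length-filter-applyUpTo : {P : ℕ → Set} (P? : ∀ i → Dec (P i)) (g : ℕ → ℕ) → ∀ m →
                          length (filter P? (applyUpTo g m)) ≡ count (does ∘ P? ∘ g) m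
length-filter-applyUpTo P? g zero    = refl
length-filter-applyUpTo P? g (suc m) with does (P? (g 0))
... | true  = cong suc (length-filter-applyUpTo P? (g ∘ suc) m)
... | false = length-filter-applyUpTo P? (g ∘ suc) m

-- u marks the unrestricted rows, the only ones in which a 1 may be put, and
-- s tells whether there is already a 1 above.
columnFillings : Bool → (ℕ → Bool) → ℕ → List (List Bool)
columnFillings s u zero    = if s then [] ∷ [] else []
columnFillings s u (suc m) =
  (if u 0 then map (true ∷_) (columnFillings true (u ∘ suc) m) else []) ++
  map (false ∷_) (columnFillings s (u ∘ suc) m)

record IsColumnFilling (s : Bool) (u : ℕ → Bool) (m : ℕ) (bs : List Bool) : Set where
  constructor isColumnFilling
  field
    fullLength : length bs ≡ m
    onesFree   : ∀ i → bs ‼ i ≡ just true → u i ≡ true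
    hasOne     : s ≡ true ⊎ ∃ λ i → bs ‼ i ≡ just true

columnFillings-sound : ∀ s u m {bs} → bs ∈ columnFillings s u m → IsColumnFilling s u m bs
columnFillings-sound true u zero (here refl) = isColumnFilling refl (λ _ ()) (inj₁ refl)
columnFillings-sound s u (suc m) bs∈ with u 0 in u0 | bs∈
... | false | p with bs , p′ , refl ← ∈-map⁻ (false ∷_) p
                with isColumnFilling l o h ← columnFillings-sound s (u ∘ suc) m p′ =
  isColumnFilling (cong suc l) (λ { (suc i) → o i }) (Sum.map₂ (λ (i , e) → suc i , e) h)
... | true  | p with ∈-++⁻ (map (true ∷_) (columnFillings true (u ∘ suc) m)) p
...   | inj₁ q with bs , q′ , refl ← ∈-map⁻ (true ∷_) q
               with isColumnFilling l o _ ← columnFillings-sound true (u ∘ suc) m q′ =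
  isColumnFilling (cong suc l) (λ { zero _ → u0 ; (suc i) → o i }) (inj₂ (0 , refl))
...   | inj₂ q with bs , q′ , refl ← ∈-map⁻ (false ∷_) q
               with isColumnFilling l o h ← columnFillings-sound s (u ∘ suc) m q′ =
  isColumnFilling (cong suc l) (λ { (suc i) → o i }) (Sum.map₂ (λ (i , e) → suc i , e) h)

columnFillings-complete : ∀ s u m {bs} → IsColumnFilling s u m bs → bs ∈ columnFillings s u m
columnFillings-complete true  u zero {[]} _ = here refl
columnFillings-complete false u zero {[]} (isColumnFilling _ _ (inj₂ (_ , ())))
-- A leading 1 forces `u 0 ≡ true`, and it already satisfies the demand for a 1, so the rest is
-- filled with `s = true`.
columnFillings-complete s u (suc m) {true ∷ bs} (isColumnFilling l o h) rewrite o 0 refl =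
  ∈-++⁺ˡ (∈-map⁺ (true ∷_) (columnFillings-complete true (u ∘ suc) m
    (isColumnFilling (suc-injective l) (o ∘ suc) (inj₁ refl))))
columnFillings-complete s u (suc m) {false ∷ bs} (isColumnFilling l o h) =
  ∈-++⁺ʳ (if u 0 then _ else []) (∈-map⁺ (false ∷_) (columnFillings-complete s (u ∘ suc) m
    (isColumnFilling (suc-injective l) (o ∘ suc) (below h))))
  where
  below : s ≡ true ⊎ (∃ λ i → (false ∷ bs) ‼ i ≡ just true) → s ≡ true ⊎ (∃ λ i → bs ‼ i ≡ just true)
  below (inj₁ e)           = inj₁ e
  below (inj₂ (suc i , e)) = inj₂ (i , e)

columnFillings-unique : ∀ s u m → Unique (columnFillings s u m)
columnFillings-unique true  u zero    = [] ∷ []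
columnFillings-unique false u zero    = []
columnFillings-unique s     u (suc m) with u 0
... | false = map⁺ ∷-injectiveʳ (columnFillings-unique s (u ∘ suc) m)
... | true  = ++⁺ (map⁺ ∷-injectiveʳ (columnFillings-unique true (u ∘ suc) m))
                  (map⁺ ∷-injectiveʳ (columnFillings-unique s (u ∘ suc) m))
                  λ (p , q) → disjoint p q
  where
  disjoint : ∀ {bs : List Bool} {xss yss} → bs ∈ map (true ∷_) xss → ¬ bs ∈ map (false ∷_) yss
  disjoint p q with _ , _ , refl ← ∈-map⁻ _ p | _ , _ , () ← ∈-map⁻ _ q

-- The recursion mirrors `columnFillings`, with `s` absorbing each 1 on the way down, so that
-- fillings and surviving rows can be counted in one induction.
unrestrictedAfter : Bool → List Bool → (ℕ → Bool) → ℕ → Bool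
unrestrictedAfter s []       u i       = u i
unrestrictedAfter s (b ∷ bs) u zero    = u 0 ∧ (b ∨ not s)
unrestrictedAfter s (b ∷ bs) u (suc i) = unrestrictedAfter (s ∨ b) bs (u ∘ suc) i

-- This is the bridge to positions: when `s` is the new diagonal cell and `u` marks the old free
-- rows, the right-hand side is the condition of `free-addColumn-suc`.
unrestrictedAfter-spec : ∀ s bs u {i} → i < length bs →
  unrestrictedAfter s bs u i ≡ true ⇔
  (u i ≡ true × ¬ (bs ‼ i ≡ just false × (s ≡ true ⊎ ∃ λ i′ → i′ < i × bs ‼ i′ ≡ just true)))
unrestrictedAfter-spec s (b ∷ bs) u {zero} lt = mk⇔ (λ e → f s b (u 0) e) (λ (e , n) → g s b (u 0) e n)
  where
  f : ∀ s b u₀ → u₀ ∧ (b ∨ not s) ≡ true →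
      u₀ ≡ true × ¬ (just b ≡ just false × (s ≡ true ⊎ ∃ λ i′ → i′ < 0 × (b ∷ bs) ‼ i′ ≡ just true))
  f s     true  true e = refl , λ ()
  f false false true e = refl , λ { (_ , inj₁ ()) ; (_ , inj₂ (_ , () , _)) }

  g : ∀ s b u₀ → u₀ ≡ true →
      ¬ (just b ≡ just false × (s ≡ true ⊎ ∃ λ i′ → i′ < 0 × (b ∷ bs) ‼ i′ ≡ just true)) →
      u₀ ∧ (b ∨ not s) ≡ true
  g s     true  u₀ refl n = refl
  g false false u₀ refl n = refl
  g true  false u₀ refl n = contradiction (refl , inj₁ refl) n
unrestrictedAfter-spec s (b ∷ bs) u {suc i} (s≤s lt) =
  mk⇔ (λ e → let (p , n) = to ih e in p , λ (z , a) → n (z , above a))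
      (λ (p , n) → from ih (p , λ (z , a) → n (z , above⁻¹ s b a)))
  where
  ih = unrestrictedAfter-spec (s ∨ b) bs (u ∘ suc) lt

  above : s ≡ true ⊎ (∃ λ i′ → i′ < suc i × (b ∷ bs) ‼ i′ ≡ just true) →
          s ∨ b ≡ true ⊎ (∃ λ i′ → i′ < i × bs ‼ i′ ≡ just true)
  above (inj₁ refl)                   = inj₁ refl
  above (inj₂ (zero , _ , refl))      = inj₁ (∨-zeroʳ s)
  above (inj₂ (suc i′ , s≤s lt , e))  = inj₂ (i′ , lt , e)

  above⁻¹ : ∀ s b → s ∨ b ≡ true ⊎ (∃ λ i′ → i′ < i × bs ‼ i′ ≡ just true) →
            s ≡ true ⊎ (∃ λ i′ → i′ < suc i × (b ∷ bs) ‼ i′ ≡ just true)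
  above⁻¹ true  b    (inj₁ e)             = inj₁ refl
  above⁻¹ false true (inj₁ e)             = inj₂ (0 , s≤s z≤n , refl)
  above⁻¹ s     b    (inj₂ (i′ , lt , e)) = inj₂ (suc i′ , s≤s lt , e)

-- Weighted counts of column fillings

-- Σₖ C(m,k) f(k)
binomialSum : (ℕ → ℕ) → ℕ → ℕ
binomialSum f zero    = f 0
binomialSum f (suc k) = binomialSum f k + binomialSum (f ∘ suc) k

-- The weight of the columns with no 1 above them, in which the rows above the
-- topmost 1 stay unrestricted.
binomialSum⁺ : (ℕ → ℕ) → ℕ → ℕ
binomialSum⁺ f zero    = 0
binomialSum⁺ f (suc k) = binomialSum⁺ (f ∘ suc) k + binomialSum (f ∘ suc) k

-- A subtraction-free form of the difference x(1 + x)ᵏ - x·xᵏ. For `f = x ^_` the sum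
-- `binomialSum⁺ f k` is Σ xʲ(1 + x)ᵏ⁻ʲ over 1 ≤ j ≤ k, where j is the position of the topmost 1
-- among the free rows, and it telescopes because (1 + x) - x = 1. The missing term `f (suc k)` is
-- the weight of the tableau with an empty row appended.
binomialSum⁺-complement : ∀ f k → f (suc k) + binomialSum⁺ f k ≡ binomialSum (f ∘ suc) k
binomialSum⁺-complement f zero    = +-identityʳ _
binomialSum⁺-complement f (suc k) = begin
  f (2 + k) + (binomialSum⁺ (f ∘ suc) k + binomialSum (f ∘ suc) k)   ≡⟨ +-assoc (f (2 + k)) _ _ ⟨
  f (2 + k) + binomialSum⁺ (f ∘ suc) k + binomialSum (f ∘ suc) k     ≡⟨ cong (_+ binomialSum (f ∘ suc) k) (binomialSum⁺-complement (f ∘ suc) k) ⟩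
  binomialSum (f ∘ suc ∘ suc) k + binomialSum (f ∘ suc) k            ≡⟨ +-comm (binomialSum (f ∘ suc ∘ suc) k) _ ⟩
  binomialSum (f ∘ suc) (suc k)                                      ∎
  where open ≡-Reasoning

sum-columnFillings-suc : ∀ s u m (h : List Bool → ℕ) →
  sum (map h (columnFillings s u (suc m))) ≡
  (if u 0 then sum (map (h ∘ (true ∷_)) (columnFillings true (u ∘ suc) m)) else 0) +
  sum (map (h ∘ (false ∷_)) (columnFillings s (u ∘ suc) m))
sum-columnFillings-suc s u m h with u 0
... | false = cong sum (sym (map-∘ (columnFillings s (u ∘ suc) m)))
... | true  = begin
  sum (map h (map (true ∷_) xs ++ map (false ∷_) ys))                ≡⟨ cong sum (map-++ h (map (true ∷_) xs) _) ⟩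
  sum (map h (map (true ∷_) xs) ++ map h (map (false ∷_) ys))        ≡⟨ sum-++ (map h (map (true ∷_) xs)) _ ⟩
  sum (map h (map (true ∷_) xs)) + sum (map h (map (false ∷_) ys))   ≡⟨ cong₂ _+_ (cong sum (sym (map-∘ xs))) (cong sum (sym (map-∘ ys))) ⟩
  _ ∎
  where
  open ≡-Reasoning
  xs = columnFillings true (u ∘ suc) m
  ys = columnFillings s (u ∘ suc) m

-- Only free rows offer a choice. Below a 1, a free row survives with a 1 and is lost with a 0: this
-- is Pascal's rule, with `f ∘ suc` recording the survivor. While no 1 has occurred, the row
-- survives either way, so both summands carry `f ∘ suc`; a 1 switches to `binomialSum`, a 0 stays
-- with `binomialSum⁺`.
sum-columnFillings : ∀ s f u m →
  sum (map (λ bs → f (count (unrestrictedAfter s bs u) m)) (columnFillings s u m)) ≡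
  (if s then binomialSum else binomialSum⁺) f (count u m)
sum-columnFillings true  f u zero = +-identityʳ _
sum-columnFillings false f u zero = refl
sum-columnFillings s f u (suc m)
  rewrite sum-columnFillings-suc s u m (λ bs → f (count (unrestrictedAfter s bs u) (suc m)))
  with u 0
sum-columnFillings true  f u (suc m) | false = sum-columnFillings true f (u ∘ suc) m
sum-columnFillings false f u (suc m) | false = sum-columnFillings false f (u ∘ suc) m
sum-columnFillings true  f u (suc m) | true  = trans
  (cong₂ _+_ (sum-columnFillings true (f ∘ suc) (u ∘ suc) m) (sum-columnFillings true f (u ∘ suc) m))
  (+-comm (binomialSum (f ∘ suc) (count (u ∘ suc) m)) _)
sum-columnFillings false f u (suc m) | true  = trans
  (cong₂ _+_ (sum-columnFillings true (f ∘ suc) (u ∘ suc) m) (sum-columnFillings false (f ∘ suc) (u ∘ suc) m))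
  (+-comm (binomialSum (f ∘ suc) (count (u ∘ suc) m)) _)

-- Tableaux

Entries : Set
Entries = ℕ → ℕ → Maybe Bool

-- No range bounds: outside the diagram every entry is nothing.
record Rules (c : ℕ) (e : Entries) : Set where
  constructor rules
  field
    columnHasOne : ∀ j → j < c → ∃ λ i → e i j ≡ just true
    noBadZero    : ∀ i j → e i j ≡ just false →
                   ¬ ((∃ λ i′ → i′ < i × e i′ j ≡ just true) × (∃ λ j′ → j′ < j × e i j′ ≡ just true))
    diagonalZero : ∀ i → i < c → e i i ≡ just false → ∀ j → ¬ e i j ≡ just true

-- The diagonal cell of row `i` lies in column `i`, since the inserted rows have lengths 1, 2, ...,
-- c from the top; hence `i ≡ j` for `Diagonal`.
Free : ℕ → Entries → ℕ → Set
Free c e i = ∀ j → e i j ≡ just false →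
             ¬ ((∃ λ i′ → i′ < i × e i′ j ≡ just true) ⊎ (i < c × i ≡ j))

record Shape (n : ℕ) (T : Filling) : Set where
  constructor shape
  open Filling T
  field
    ferrers       : IsFerrers columns rowLengths
    halfPerimeter : length rowLengths + columns ≡ n
    fills         : map length content ≡ shiftedLengths columns rowLengths

module _ {c : ℕ} {e e′ : Entries} (e≗e′ : ∀ i j → e i j ≡ e′ i j) where

  -- Pointwise agreement is what `entry-addRow` and `entry-addColumn` provide, and the rules look at
  -- single entries only.
  rules-resp : Rules c e → Rules c e′
  rules-resp (rules one bad diag) = rules
    (λ j lt → let (i , p) = one j lt in i , fwd p)
    (λ { i j z ((i′ , lt , p) , (j′ , lt′ , q)) →
         bad i j (bwd z) ((i′ , lt , bwd p) , (j′ , lt′ , bwd q)) })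
    (λ i lt z j p → diag i lt (bwd z) j (bwd p))
    where
    fwd : ∀ {i j b} → e i j ≡ just b → e′ i j ≡ just b
    fwd = trans (sym (e≗e′ _ _))
    bwd : ∀ {i j b} → e′ i j ≡ just b → e i j ≡ just b
    bwd = trans (e≗e′ _ _)

  free-resp : ∀ {i} → Free c e i → Free c e′ i
  free-resp fr j z (inj₁ (i′ , lt , p)) =
    fr j (trans (e≗e′ _ _) z) (inj₁ (i′ , lt , trans (e≗e′ _ _) p))
  free-resp fr j z (inj₂ d) = fr j (trans (e≗e′ _ _) z) (inj₂ d)

length-shiftedLengths : ∀ c ls → length (shiftedLengths c ls) ≡ c + length ls
length-shiftedLengths c ls = trans (length-++ (map suc (upTo c)))
  (cong (_+ length ls) (trans (length-map suc (upTo c)) (length-applyUpTo id c)))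

shiftedLengths-diagonal : ∀ c ls {i} → i < c → shiftedLengths c ls ‼ i ≡ just (suc i)
shiftedLengths-diagonal c ls {i} lt =
  subst (λ xs → (xs ++ ls) ‼ i ≡ just (suc i)) (sym (map-applyUpTo id suc c)) (‼-applyUpTo suc ls lt)

shiftedLengths-bounded : ∀ {c ls} → All (_≤ c) ls → All (_≤ c) (shiftedLengths c ls)
shiftedLengths-bounded {c} fits = All.++⁺ (All.map⁺ (All.applyUpTo⁺₁ id c id)) fits

shiftedLengths-row : ∀ c ls → shiftedLengths c (ls ∷ʳ 0) ≡ shiftedLengths c ls ∷ʳ 0
shiftedLengths-row c ls = sym (++-assoc (map suc (upTo c)) ls _)

-- The order 1, 2, ..., c of the inserted rows makes this work: a new left column lengthens every
-- old row by one, and the single extra row goes on top.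
shiftedLengths-column : ∀ c ls → shiftedLengths (suc c) (map suc ls) ≡ 1 ∷ map suc (shiftedLengths c ls)
shiftedLengths-column c ls = cong (1 ∷_) (begin
  map suc (applyUpTo suc c) ++ map suc ls         ≡⟨ cong (λ xs → map suc xs ++ map suc ls) (map-applyUpTo id suc c) ⟨
  map suc (map suc (upTo c)) ++ map suc ls        ≡⟨ map-++ suc (map suc (upTo c)) ls ⟨
  map suc (shiftedLengths c ls)                   ∎)
  where open ≡-Reasoning

module _ (T : Filling) where
  open Filling T

  diagonal⇔ : ∀ {i j} → Diagonal i j ⇔ (i < columns × i ≡ j)
  diagonal⇔ = mk⇔
    (λ (lt , eq) → lt , suc-injective (just-injective
      (trans (sym (shiftedLengths-diagonal columns rowLengths lt)) eq)))
    (λ { (lt , refl) → lt , shiftedLengths-diagonal columns rowLengths lt })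

  entry-row : ∀ {i j b} → entry i j ≡ just b → ∃ λ row → content ‼ i ≡ just row × row ‼ j ≡ just b
  entry-row {i} eq with content ‼ i
  ... | just row = row , refl , eq

  module _ {n} (sh : Shape n T) where
    open Shape sh

    length-content : length content ≡ shiftedRows
    length-content = begin
      length content                             ≡⟨ length-map length content ⟨
      length (map length content)                ≡⟨ cong length fills ⟩
      length (shiftedLengths columns rowLengths) ≡⟨ length-shiftedLengths columns rowLengths ⟩
      shiftedRows                                ∎
      where open ≡-Reasoning

    entry-boundˡ : ∀ {i j b} → entry i j ≡ just b → i < shiftedRows
    entry-boundˡ eq with row , p , q ← entry-row eq = subst (_ <_) length-content (‼-bound content p)

    entry-boundʳ : ∀ {i j b} → entry i j ≡ just b → j < columns
    entry-boundʳ eq with row , p , q ← entry-row eq = <-≤-trans (‼-bound row q)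
      (All.lookup (All.map⁻ (subst (All (_≤ columns)) (sym fills)
        (shiftedLengths-bounded (IsFerrers.fits ferrers)))) (‼-∈ content p))

    unrestricted⇔free : ∀ {i} → Unrestricted i ⇔ Free columns entry i
    unrestricted⇔free = mk⇔
      (λ ur j z r → ur (j , entry-boundʳ z , z , Sum.map₂ (from diagonal⇔) r))
      (λ { fr (j , _ , z , r) → fr j z (Sum.map₂ (to diagonal⇔) r) })

  isTableau⇔ : ∀ {n} → IsTableau n T ⇔ (Shape n T × Rules columns entry)
  isTableau⇔ {n} = mk⇔ f g
    where
    f : IsTableau n T → Shape n T × Rules columns entry
    f (isTableau fe hp fi one bad diag) = sh , rules
      (λ j lt → let (i , _ , p) = one j lt in i , p)
      (λ i j z → bad i (entry-boundˡ sh z) j (entry-boundʳ sh z) z)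
      (λ i lt z j p → diag i (entry-boundˡ sh z) i lt (from diagonal⇔ (lt , refl)) z j (entry-boundʳ sh p) p)
      where sh = shape fe hp fi

    g : Shape n T × Rules columns entry → IsTableau n T
    g (sh@(shape fe hp fi) , rules one bad diag) = isTableau fe hp fi
      (λ j lt → let (i , p) = one j lt in i , entry-boundˡ sh p , p)
      (λ i _ j _ → bad i j)
      (λ i _ j _ d z j′ _ → diag′ i j (to diagonal⇔ d) z j′)
      where
      diag′ : ∀ i j → i < columns × i ≡ j → Zero i j → ∀ j′ → ¬ One i j′
      diag′ i j (lt , refl) = diag i lt

-- The two ways of enlarging a tableau

data Step : Set where
  row    : Step
  column : Bool → List Bool → Step

-- In `column b bs` the bit `b` is the new diagonal cell and `bs` the column below it. As `zipWith`
-- truncates, the result is as intended only if `bs` has one bit for each row of the content.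
grow : Filling → Step → Filling
grow (mkFilling c ls xss) row           = mkFilling c (ls ∷ʳ 0) (xss ∷ʳ [])
grow (mkFilling c ls xss) (column b bs) = mkFilling (suc c) (map suc ls) ((b ∷ []) ∷ zipWith _∷_ bs xss)

-- An empty row and a missing row both read as `nothing`, so a `row` step leaves the rules and the
-- freedom of every row index untouched.
entry-addRow : ∀ (xss : List (List Bool)) i j → (xss ‼ i >>= (_‼ j)) ≡ ((xss ∷ʳ []) ‼ i >>= (_‼ j))
entry-addRow []         zero    j = refl
entry-addRow []         (suc i) j = refl
entry-addRow (xs ∷ xss) zero    j = refl
entry-addRow (xs ∷ xss) (suc i) j = entry-addRow xss i j

-- Old cells move by one in both directions, hence diagonal cells to diagonal cells, and old rules
-- reappear as new rules at successor indices.
addColumn : Entries → Bool → List Bool → Entries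
addColumn e b bs zero    zero    = just b
addColumn e b bs zero    (suc j) = nothing
addColumn e b bs (suc i) zero    = bs ‼ i
addColumn e b bs (suc i) (suc j) = e i j

entry-addColumn : ∀ T b bs → length bs ≡ length (Filling.content T) → ∀ i j →
                  addColumn (Filling.entry T) b bs i j ≡ Filling.entry (grow T (column b bs)) i j
entry-addColumn T b bs l zero    zero    = refl
entry-addColumn T b bs l zero    (suc j) = refl
entry-addColumn T b bs l (suc i) zero    = first bs (Filling.content T) l i
  where
  first : ∀ (bs : List Bool) xss → length bs ≡ length xss → ∀ i → bs ‼ i ≡ (zipWith _∷_ bs xss ‼ i >>= (_‼ 0))
  first []       []         l i       = refl
  first (b ∷ bs) (xs ∷ xss) l zero    = refl
  first (b ∷ bs) (xs ∷ xss) l (suc i) = first bs xss (suc-injective l) i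
entry-addColumn T b bs l (suc i) (suc j) = rest bs (Filling.content T) l i
  where
  rest : ∀ (bs : List Bool) xss → length bs ≡ length xss → ∀ i →
         (xss ‼ i >>= (_‼ j)) ≡ (zipWith _∷_ bs xss ‼ i >>= (_‼ suc j))
  rest []       []         l i       = refl
  rest (b ∷ bs) (xs ∷ xss) l zero    = refl
  rest (b ∷ bs) (xs ∷ xss) l (suc i) = rest bs xss (suc-injective l) i

module _ (c : ℕ) (e : Entries) (b : Bool) (bs : List Bool) where

  private
    e′ = addColumn e b bs

  -- A 1 in the new column is to the left of every old cell of its row: rule (2) then excludes 0's
  -- below a 1, and rule (3) a 0 on the diagonal, which together say that the row was free. The new
  -- cells themselves have nothing to their left, so their 0's never break rule (2).
  rules-addColumn : Rules (suc c) e′ ⇔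
    (Rules c e × (∀ i → bs ‼ i ≡ just true → Free c e i) × (b ≡ true ⊎ ∃ λ i → bs ‼ i ≡ just true))
  rules-addColumn = mk⇔ f g
    where
    f : Rules (suc c) e′ → _
    f (rules one bad diag) = rules one′ bad′ (λ i lt z j → diag (suc i) (s≤s lt) z (suc j)) , fr , has
      where
      one′ : ∀ j → j < c → ∃ λ i → e i j ≡ just true
      one′ j lt with one (suc j) (s≤s lt)
      -- The witness cannot be row 0, which has no cell beyond column 0.
      ... | suc i , p = i , p

      bad′ : ∀ i j → e i j ≡ just false →
             ¬ ((∃ λ i′ → i′ < i × e i′ j ≡ just true) × (∃ λ j′ → j′ < j × e i j′ ≡ just true))
      bad′ i j z ((i′ , lt , p) , (j′ , lt′ , q)) =
        bad (suc i) (suc j) z ((suc i′ , s≤s lt , p) , (suc j′ , s≤s lt′ , q))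

      fr : ∀ i → bs ‼ i ≡ just true → Free c e i
      fr i o j z (inj₁ (i′ , lt , p)) = bad (suc i) (suc j) z ((suc i′ , s≤s lt , p) , (0 , s≤s z≤n , o))
      fr i o j z (inj₂ (lt , refl))   = diag (suc i) (s≤s lt) z 0 o

      has : b ≡ true ⊎ ∃ λ i → bs ‼ i ≡ just true
      has with one 0 (s≤s z≤n)
      ... | zero  , p = inj₁ (just-injective p)
      ... | suc i , p = inj₂ (i , p)

    g : _ → Rules (suc c) e′
    g (rules one bad diag , fr , has) = rules one′ bad′ diag′
      where
      one′ : ∀ j → j < suc c → ∃ λ i → e′ i j ≡ just true
      one′ zero    _        = [ (λ { refl → 0 , refl }) , (λ (i , p) → suc i , p) ]′ has
      one′ (suc j) (s≤s lt) = let (i , p) = one j lt in suc i , p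

      bad′ : ∀ i j → e′ i j ≡ just false →
             ¬ ((∃ λ i′ → i′ < i × e′ i′ j ≡ just true) × (∃ λ j′ → j′ < j × e′ i j′ ≡ just true))
      bad′ (suc i) (suc j) z ((suc i′ , s≤s lt , p) , (zero   , _       , o)) =
        fr i o j z (inj₁ (i′ , lt , p))
      bad′ (suc i) (suc j) z ((suc i′ , s≤s lt , p) , (suc j′ , s≤s lt′ , q)) =
        bad i j z ((i′ , lt , p) , (j′ , lt′ , q))

      diag′ : ∀ i → i < suc c → e′ i i ≡ just false → ∀ j → ¬ e′ i j ≡ just true
      diag′ zero    _        refl zero    ()
      diag′ (suc i) (s≤s lt) z    zero    o = fr i o i z (inj₂ (lt , refl))
      diag′ (suc i) (s≤s lt) z    (suc j) p = diag i lt z j p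

  free-addColumn-zero : Free (suc c) e′ 0 ⇔ b ≡ true
  free-addColumn-zero = mk⇔ (f b refl) (λ { refl zero () ; refl (suc j) () })
    where
    f : ∀ b′ → b ≡ b′ → Free (suc c) e′ 0 → b′ ≡ true
    f true  _    _  = refl
    f false refl fr = contradiction (inj₂ (s≤s z≤n , refl)) (fr 0 refl)

  -- Above the old columns nothing is added, so only the new cell of the row can change its status.
  -- That cell is not diagonal; it is restricted exactly when it is 0 with a 1 above, either in the
  -- diagonal cell `b` or in `bs`.
  free-addColumn-suc : ∀ i → Free (suc c) e′ (suc i) ⇔
    (Free c e i × ¬ (bs ‼ i ≡ just false × (b ≡ true ⊎ ∃ λ i′ → i′ < i × bs ‼ i′ ≡ just true)))
  free-addColumn-suc i = mk⇔ f g
    where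
    f : Free (suc c) e′ (suc i) → _
    f fr = (λ { j z (inj₁ (i′ , lt , p)) → fr (suc j) z (inj₁ (suc i′ , s≤s lt , p))
              ; j z (inj₂ (lt , refl))   → fr (suc j) z (inj₂ (s≤s lt , refl)) }) ,
           (λ { (z , inj₁ refl)          → fr 0 z (inj₁ (0 , s≤s z≤n , refl))
              ; (z , inj₂ (i′ , lt , p)) → fr 0 z (inj₁ (suc i′ , s≤s lt , p)) })

    g : _ → Free (suc c) e′ (suc i)
    g (fr , n) zero    z (inj₁ (zero   , _      , p)) = n (z , inj₁ (just-injective p))
    g (fr , n) zero    z (inj₁ (suc i′ , s≤s lt , p)) = n (z , inj₂ (i′ , lt , p))
    g (fr , n) (suc j) z (inj₁ (suc i′ , s≤s lt , p)) = fr j z (inj₁ (i′ , lt , p))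
    g (fr , n) (suc j) z (inj₂ (s≤s lt , refl))       = fr j z (inj₂ (lt , refl))

-- Diagram shapes under the two steps

Linked-∷ʳ0 : ∀ {ls} → Linked _≥_ ls → Linked _≥_ (ls ∷ʳ 0)
Linked-∷ʳ0 []       = [-]
Linked-∷ʳ0 [-]      = z≤n ∷ [-]
Linked-∷ʳ0 (p ∷ ps) = p ∷ Linked-∷ʳ0 ps

Linked-∷ʳ⁻ : ∀ ls {l} → Linked _≥_ (ls ∷ʳ l) → Linked _≥_ ls
Linked-∷ʳ⁻ []           _        = []
Linked-∷ʳ⁻ (k ∷ [])     _        = [-]
Linked-∷ʳ⁻ (k ∷ l ∷ ls) (p ∷ ps) = p ∷ Linked-∷ʳ⁻ (l ∷ ls) ps

-- This tells which step came last. By weak decrease a positive last length makes all lengths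
-- positive, so a column can be removed; the empty list belongs to that case as well.
decreasing-split : ∀ {ls} → Linked _≥_ ls → (∃ λ ks → ls ≡ ks ∷ʳ 0) ⊎ (∃ λ ks → ls ≡ map suc ks)
decreasing-split {[]}         _     = inj₂ ([] , refl)
decreasing-split {zero ∷ []}  _     = inj₁ ([] , refl)
decreasing-split {suc l ∷ []} _     = inj₂ (l ∷ [] , refl)
decreasing-split {l ∷ _ ∷ _} (l≥ ∷ d) with decreasing-split d
... | inj₁ (ks , eq) = inj₁ (l ∷ ks , cong (l ∷_) eq)
decreasing-split {suc l ∷ _ ∷ _} (l≥ ∷ d) | inj₂ (ks , eq) = inj₂ (l ∷ ks , cong (suc l ∷_) eq)
decreasing-split {zero ∷ zero ∷ _} (l≥ ∷ d) | inj₂ ([] , ())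
decreasing-split {zero ∷ zero ∷ _} (l≥ ∷ d) | inj₂ (k ∷ ks , ())

length-∷ʳ : {A : Set} (xs : List A) {x : A} → length (xs ∷ʳ x) ≡ suc (length xs)
length-∷ʳ xs = trans (length-++ xs) (+-comm (length xs) 1)

unsnoc-rows : ∀ {xss : List (List Bool)} ks → map length xss ≡ ks ∷ʳ 0 →
              ∃ λ yss → xss ≡ yss ∷ʳ [] × map length yss ≡ ks
unsnoc-rows {[] ∷ []}      []           eq = [] , refl , refl
unsnoc-rows {_ ∷ _ ∷ _}    []           eq with () ← ∷-injectiveʳ eq
unsnoc-rows {(_ ∷ _) ∷ []} []           ()
unsnoc-rows {xs ∷ xss}     (k ∷ ks)     eq with yss , p , q ← unsnoc-rows ks (∷-injectiveʳ eq) =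
  xs ∷ yss , cong (xs ∷_) p , cong₂ _∷_ (∷-injectiveˡ eq) q
unsnoc-rows {[]} [] ()

uncons-rows : ∀ {xss : List (List Bool)} ks → map length xss ≡ map suc ks →
              ∃₂ λ bs yss → length bs ≡ length yss × xss ≡ zipWith _∷_ bs yss × map length yss ≡ ks
uncons-rows {[]}             []       eq = [] , [] , refl , refl , refl
uncons-rows {(b ∷ xs) ∷ xss} (k ∷ ks) eq
  with bs , yss , l , p , q ← uncons-rows ks (∷-injectiveʳ eq) =
  b ∷ bs , xs ∷ yss , cong suc l , cong (_ ∷_) p , cong₂ _∷_ (suc-injective (∷-injectiveˡ eq)) q

map-length-zipWith : ∀ (bs : List Bool) xss → length bs ≡ length xss →
                     map length (zipWith _∷_ bs xss) ≡ map suc (map length xss)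
map-length-zipWith []       []         l = refl
map-length-zipWith (b ∷ bs) (xs ∷ xss) l = cong (_ ∷_) (map-length-zipWith bs xss (suc-injective l))

zipWith-∷-injective : ∀ {bs bs′ : List Bool} {xss xss′ : List (List Bool)} → length bs ≡ length xss → length bs′ ≡ length xss′ →
                      zipWith {C = List Bool} _∷_ bs xss ≡ zipWith _∷_ bs′ xss′ → bs ≡ bs′ × xss ≡ xss′
zipWith-∷-injective {[]}     {[]}     {[]}       {[]}       l l′ eq = refl , refl
zipWith-∷-injective {[]}     {_ ∷ _} {[]}       {_ ∷ _}      l l′ ()
zipWith-∷-injective {_ ∷ _}  {[]}     {_ ∷ _}   {[]}         l l′ ()
zipWith-∷-injective {b ∷ bs} {_ ∷ _} {xs ∷ xss} {_ ∷ _} l l′ eq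
  with heads , tails ← ∷-injective eq
  with refl , refl ← ∷-injective heads
     | refl , refl ← zipWith-∷-injective (suc-injective l) (suc-injective l′) tails = refl , refl

-- Keeps the two kinds of step apart in `grow-injective`.
∷ʳ0≢map-suc : ∀ ls ks → ls ∷ʳ 0 ≢ map suc ks
∷ʳ0≢map-suc []       (_ ∷ _)  ()
∷ʳ0≢map-suc (_ ∷ ls) (_ ∷ ks) eq = ∷ʳ0≢map-suc ls ks (∷-injectiveʳ eq)

shape-row : ∀ {n T} → Shape n T → Shape (suc n) (grow T row)
shape-row {T = mkFilling c ls xss} (shape (isFerrers d f) hp fi) = shape
  (isFerrers (Linked-∷ʳ0 d) (All.++⁺ f (z≤n ∷ [])))
  (trans (cong (_+ c) (length-∷ʳ ls)) (cong suc hp))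
  (trans (map-++ length xss _) (trans (cong (_∷ʳ 0) fi) (sym (shiftedLengths-row c ls))))

shape-row⁻ : ∀ {n c ls xss} → Shape (suc n) (mkFilling c (ls ∷ʳ 0) xss) →
             ∃ λ yss → xss ≡ yss ∷ʳ [] × Shape n (mkFilling c ls yss)
shape-row⁻ {c = c} {ls} (shape (isFerrers d f) hp fi)
  with yss , p , q ← unsnoc-rows _ (trans fi (shiftedLengths-row c ls)) =
  yss , p , shape (isFerrers (Linked-∷ʳ⁻ ls d) (proj₁ (All.++⁻ ls f)))
                  (suc-injective (trans (sym (cong (_+ c) (length-∷ʳ ls))) hp)) q

shape-column : ∀ {n T b bs} → length bs ≡ length (Filling.content T) →
               Shape n T → Shape (suc n) (grow T (column b bs))
shape-column {T = mkFilling c ls xss} {b} {bs} l (shape (isFerrers d f) hp fi) = shape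
  (isFerrers (Linked.map⁺ (Linked.map s≤s d)) (All.map⁺ (All.map s≤s f)))
  (trans (cong (_+ suc c) (length-map suc ls)) (trans (+-suc (length ls) c) (cong suc hp)))
  (trans (cong (1 ∷_) (trans (map-length-zipWith bs xss l) (cong (map suc) fi)))
         (sym (shiftedLengths-column c ls)))

shape-column⁻ : ∀ {n c ls xss} → Shape (suc n) (mkFilling (suc c) (map suc ls) xss) →
                ∃ λ b → ∃₂ λ bs yss → length bs ≡ length yss × xss ≡ (b ∷ []) ∷ zipWith _∷_ bs yss ×
                                      Shape n (mkFilling c ls yss)
shape-column⁻ {c = c} {ls} {xss} (shape (isFerrers d f) hp fi)
  with xss | trans fi (shiftedLengths-column c ls)
... | (b ∷ []) ∷ xss′ | eq with bs , yss , l , p , q ← uncons-rows _ (∷-injectiveʳ eq) =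
  b , bs , yss , l , cong (_ ∷_) p , shape
    (isFerrers (Linked.map (λ { (s≤s p) → p }) (Linked.map⁻ d)) (All.map (λ { (s≤s p) → p }) (All.map⁻ f)))
    (suc-injective (trans (sym (trans (cong (_+ suc c) (length-map suc ls)) (+-suc (length ls) c))) hp))
    q
... | [] ∷ _          | ()
... | (_ ∷ _ ∷ _) ∷ _ | ()

-- Admissible steps and their effect on unrestricted rows

does-true⇔ : {A : Set} (a? : Dec A) → does a? ≡ true ⇔ A
does-true⇔ (yes a) = mk⇔ (λ _ → a) (λ _ → refl)
does-true⇔ (no ¬a) = mk⇔ (λ ()) (λ a → contradiction a ¬a)

isFree : Filling → ℕ → Bool
isFree T i = does (Filling.unrestricted? T i)

isFree⇔free : ∀ {n T i} → Shape n T → isFree T i ≡ true ⇔ Free (Filling.columns T) (Filling.entry T) i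
isFree⇔free {T = T} {i} sh = unrestricted⇔free T sh ⇔-∘ does-true⇔ (Filling.unrestricted? T i)

U-count : ∀ T → U T ≡ count (isFree T) (Filling.shiftedRows T)
U-count T = length-filter-applyUpTo (Filling.unrestricted? T) id (Filling.shiftedRows T)

-- The diagonal cell `b` is on top of the new column, so it is the initial answer to whether there
-- is a 1 above.
columnSteps : Filling → Bool → List Step
columnSteps T b = map (column b) (columnFillings b (isFree T) (Filling.shiftedRows T))

steps : Filling → List Step
steps T = row ∷ columnSteps T true ++ columnSteps T false

IsColumnStep : Filling → Bool → List Bool → Set
IsColumnStep T b bs = IsColumnFilling b (isFree T) (Filling.shiftedRows T) bs

column∈steps : ∀ T {b bs} → column b bs ∈ steps T ⇔ IsColumnStep T b bs
column∈steps T {b} {bs} = mk⇔ f (g b)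
  where
  step : ∀ b′ → column b bs ∈ columnSteps T b′ → IsColumnStep T b bs
  step b′ p with bs , q , refl ← ∈-map⁻ (column b′) p =
    columnFillings-sound b (isFree T) (Filling.shiftedRows T) q

  f : column b bs ∈ steps T → IsColumnStep T b bs
  f (there p) = [ step true , step false ]′ (∈-++⁻ (columnSteps T true) p)

  complete : ∀ b → IsColumnStep T b bs → column b bs ∈ columnSteps T b
  complete b v = ∈-map⁺ (column b) (columnFillings-complete b (isFree T) (Filling.shiftedRows T) v)

  g : ∀ b → IsColumnStep T b bs → column b bs ∈ steps T
  g true  v = there (∈-++⁺ˡ (complete true v))
  g false v = there (∈-++⁺ʳ (columnSteps T true) (complete false v))

steps-unique : ∀ T → Unique (steps T)
steps-unique T =
  All.++⁺ (row≢column true) (row≢column false) ∷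
  ++⁺ (unique true) (unique false) λ (p , q) → disjoint p q
  where
  row≢column : ∀ b → All (row ≢_) (columnSteps T b)
  row≢column b = All.map⁺ (All.universal (λ _ ()) (columnFillings b (isFree T) (Filling.shiftedRows T)))

  unique : ∀ b → Unique (columnSteps T b)
  unique b = map⁺ (λ { refl → refl }) (columnFillings-unique b (isFree T) (Filling.shiftedRows T))

  disjoint : ∀ {s} → s ∈ columnSteps T true → ¬ s ∈ columnSteps T false
  disjoint p q with _ , _ , refl ← ∈-map⁻ (column true) p | _ , _ , () ← ∈-map⁻ (column false) q

module _ {n : ℕ} {T : Filling} (t : IsTableau n T) where
  open Filling T

  private
    sh = proj₁ (to (isTableau⇔ T) t)
    ru = proj₂ (to (isTableau⇔ T) t)

  columnStep-length : ∀ {b bs} → IsColumnStep T b bs → length bs ≡ length content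
  columnStep-length v = trans (IsColumnFilling.fullLength v) (sym (length-content T sh))

  grow-isTableau : ∀ {s} → s ∈ steps T → IsTableau (suc n) (grow T s)
  grow-isTableau {row}         _  =
    from (isTableau⇔ (grow T row)) (shape-row sh , rules-resp (entry-addRow content) ru)
  grow-isTableau {column b bs} s∈ =
    from (isTableau⇔ (grow T (column b bs))) (shape-column len sh ,
      rules-resp (entry-addColumn T b bs len) (from (rules-addColumn _ _ b bs)
        (ru , (λ i o → to (isFree⇔free sh) (onesFree i o)) , hasOne)))
    where
    v   = to (column∈steps T) s∈
    len = columnStep-length v
    open IsColumnFilling v

  -- The entries do not change, so `isFree` takes the same values; only the range grows by the index
  -- `shiftedRows`, where there is no entry and therefore no restricted 0.
  U-addRow : U (grow T row) ≡ suc (U T)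
  U-addRow = begin
    U (grow T row)                                              ≡⟨ U-count (grow T row) ⟩
    count (isFree (grow T row)) (columns + length (rowLengths ∷ʳ 0))
                                                                ≡⟨ cong (count (isFree (grow T row))) (trans (cong (columns +_) (length-∷ʳ rowLengths)) (+-suc columns (length rowLengths))) ⟩
    count (isFree (grow T row)) (suc shiftedRows)               ≡⟨ count-cong (suc shiftedRows) (λ i _ → same i) ⟩
    count (isFree T) (suc shiftedRows)                          ≡⟨ count-snoc (isFree T) shiftedRows lastFree ⟩
    suc (count (isFree T) shiftedRows)                          ≡⟨ cong suc (U-count T) ⟨
    suc (U T)                                                   ∎
    where
    open ≡-Reasoning
    same : ∀ i → isFree (grow T row) i ≡ isFree T i
    same i = ⇔→≡ (⇔-sym (isFree⇔free sh) ⇔-∘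
      (mk⇔ (free-resp (λ i j → sym (entry-addRow content i j))) (free-resp (entry-addRow content)) ⇔-∘
       isFree⇔free (shape-row sh)))

    lastFree : isFree T shiftedRows ≡ true
    lastFree = from (isFree⇔free sh) (λ j z → contradiction (entry-boundˡ T sh z) (<-irrefl refl))

  U-addColumn : ∀ {b bs} → IsColumnStep T b bs → U (grow T (column b bs)) ≡
                (if b then 1 else 0) + count (unrestrictedAfter b bs (isFree T)) shiftedRows
  U-addColumn {b} {bs} v = begin
    U T′                                                        ≡⟨ U-count T′ ⟩
    count (isFree T′) (suc (columns + length (map suc rowLengths)))
      ≡⟨ cong (λ k → count (isFree T′) (suc (columns + k))) (length-map suc rowLengths) ⟩
    count (isFree T′) (suc shiftedRows)                         ≡⟨ top (isFree T′ 0) b refl (⇔→≡ head) ⟩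
    (if b then 1 else 0) + count (isFree T′ ∘ suc) shiftedRows
      ≡⟨ cong ((if b then 1 else 0) +_) (count-cong shiftedRows tail) ⟩
    (if b then 1 else 0) + count (unrestrictedAfter b bs (isFree T)) shiftedRows ∎
    where
    open ≡-Reasoning
    T′ = grow T (column b bs)
    len = columnStep-length v
    e≗ = entry-addColumn T b bs len

    top : ∀ x b → isFree T′ 0 ≡ x → x ≡ b →
          count (isFree T′) (suc shiftedRows) ≡ (if b then 1 else 0) + count (isFree T′ ∘ suc) shiftedRows
    top true  true  eq refl rewrite eq = refl
    top false false eq refl rewrite eq = refl

    entries : ∀ {i} → isFree T′ i ≡ true ⇔ Free (suc columns) (addColumn entry b bs) i
    entries = mk⇔ (free-resp (λ i j → sym (e≗ i j))) (free-resp e≗) ⇔-∘ isFree⇔free (shape-column len sh)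

    head : isFree T′ 0 ≡ true ⇔ b ≡ true
    head = free-addColumn-zero columns entry b bs ⇔-∘ entries

    tail : ∀ i → i < shiftedRows → isFree T′ (suc i) ≡ unrestrictedAfter b bs (isFree T) i
    tail i lt = ⇔→≡ (
      ⇔-sym (unrestrictedAfter-spec b bs (isFree T) (subst (i <_) (sym (IsColumnFilling.fullLength v)) lt)) ⇔-∘
      (mk⇔ (λ (p , q) → from (isFree⇔free sh) p , q) (λ (p , q) → to (isFree⇔free sh) p , q) ⇔-∘
       (free-addColumn-suc columns entry b bs i ⇔-∘ entries)))

-- The last step of a tableau and its uniqueness

grow-surjective : ∀ {n T′} → IsTableau (suc n) T′ → ∃₂ λ T s → IsTableau n T × s ∈ steps T × T′ ≡ grow T s
grow-surjective {T′ = T′} t′ with to (isTableau⇔ T′) t′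
... | sh , ru with decreasing-split (IsFerrers.decreasing (Shape.ferrers sh))
... | inj₁ (ls , refl) with yss , refl , sh₀ ← shape-row⁻ sh =
  T , row , from (isTableau⇔ T) (sh₀ , rules-resp (λ i j → sym (entry-addRow yss i j)) ru) , here refl , refl
  where T = mkFilling (Filling.columns T′) ls yss
-- Without columns no positive length fits, so there would be no rows either, against the
-- half-perimeter `suc n`.
grow-surjective {T′ = mkFilling zero    _ xss} t′ | sh , ru | inj₂ ([]     , refl) with () ← Shape.halfPerimeter sh
grow-surjective {T′ = mkFilling zero    _ xss} t′ | sh , ru | inj₂ (k ∷ ks , refl) with () ∷ _ ← IsFerrers.fits (Shape.ferrers sh)
grow-surjective {T′ = mkFilling (suc c) _ xss} t′ | sh , ru | inj₂ (ks     , refl)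
  with b , bs , yss , l , refl , sh₀ ← shape-column⁻ sh
  with ru₀ , fr , has ← to (rules-addColumn c (Filling.entry (mkFilling c ks yss)) b bs)
         (rules-resp (λ i j → sym (entry-addColumn (mkFilling c ks yss) b bs l i j)) ru) =
  T , column b bs , from (isTableau⇔ T) (sh₀ , ru₀) ,
  from (column∈steps T) (isColumnFilling (trans l (length-content T sh₀)) (λ i o → from (isFree⇔free sh₀) (fr i o)) has) ,
  refl
  where T = mkFilling c ks yss

-- The row lengths reveal the kind of step, and each field of the filling then gives back its old
-- value. Legality of a column step fixes the length of `bs`, so that `zipWith` loses no
-- information.
grow-injective : ∀ {n T T′ s s′} → IsTableau n T → IsTableau n T′ → s ∈ steps T → s′ ∈ steps T′ →
                 grow T s ≡ grow T′ s′ → (T , s) ≡ (T′ , s′)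
grow-injective {T = T} {T′} {row} {row} t t′ p p′ eq
  with refl ← cong Filling.columns eq
     | refl ← ∷ʳ-injectiveˡ _ _ (cong Filling.rowLengths eq)
     | refl ← ∷ʳ-injectiveˡ _ _ (cong Filling.content eq) = refl
grow-injective {s = row} {column _ _} t t′ p p′ eq =
  contradiction (cong Filling.rowLengths eq) (∷ʳ0≢map-suc _ _)
grow-injective {s = column _ _} {row} t t′ p p′ eq =
  contradiction (sym (cong Filling.rowLengths eq)) (∷ʳ0≢map-suc _ _)
grow-injective {T = T} {T′} {column b bs} {column b′ bs′} t t′ p p′ eq
  with refl ← suc-injective (cong Filling.columns eq)
     | refl ← map-injective suc-injective (cong Filling.rowLengths eq)
     | refl ← ∷-injectiveˡ (∷-injectiveˡ (cong Filling.content eq))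
     | refl , refl ← zipWith-∷-injective (columnStep-length t (to (column∈steps T) p))
                       (columnStep-length t′ (to (column∈steps T′) p′)) (∷-injectiveʳ (cong Filling.content eq)) = refl

-- Duplicate-free lists with the same members agree up to order, and sums do not see the order.
𝓑-suc : ∀ n → 𝓑 (suc n) ↭ map (uncurry grow) (pairs steps (𝓑 n))
𝓑-suc n = ∼bag⇒↭ (unique∧set⇒bag (𝓑-unique (suc n))
  (map-unique inj (pairs-unique steps steps-unique (𝓑-unique n))) (mk⇔ f g))
  where
  inj : ∀ {x y} → x ∈ pairs steps (𝓑 n) → y ∈ pairs steps (𝓑 n) → uncurry grow x ≡ uncurry grow y → x ≡ y
  inj p q with T∈ , s∈ ← ∈-pairs⁻ steps {xs = 𝓑 n} p | T′∈ , s′∈ ← ∈-pairs⁻ steps {xs = 𝓑 n} q =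
    grow-injective (to (∈-𝓑 {n}) T∈) (to (∈-𝓑 {n}) T′∈) s∈ s′∈

  f : ∀ {T′} → T′ ∈ 𝓑 (suc n) → T′ ∈ map (uncurry grow) (pairs steps (𝓑 n))
  f p with T , s , t , s∈ , refl ← grow-surjective (to (∈-𝓑 {suc n}) p) =
    ∈-map⁺ (uncurry grow) (∈-pairs⁺ steps (from (∈-𝓑 {n}) t) s∈)

  g : ∀ {T′} → T′ ∈ map (uncurry grow) (pairs steps (𝓑 n)) → T′ ∈ 𝓑 (suc n)
  g p with (T , s) , q , refl ← ∈-map⁻ (uncurry grow) p with T∈ , s∈ ← ∈-pairs⁻ steps {xs = 𝓑 n} q =
    from (∈-𝓑 {suc n}) (grow-isTableau (to (∈-𝓑 {n}) T∈) s∈)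

-- One step of the recursion for weighted sums

sum-columnSteps : ∀ {n T} → IsTableau n T → ∀ f b →
  sum (map (f ∘ U ∘ grow T) (columnSteps T b)) ≡
  (if b then binomialSum (f ∘ suc) (U T) else binomialSum⁺ f (U T))
sum-columnSteps {T = T} t f b = begin
  sum (map (f ∘ U ∘ grow T) (columnSteps T b))                ≡⟨ cong sum (map-∘ bss) ⟨
  sum (map (f ∘ U ∘ grow T ∘ column b) bss)                   ≡⟨ sum-map-cong (λ bs∈ → cong f (U-addColumn t (columnFillings-sound b (isFree T) m bs∈))) ⟩
  sum (map (λ bs → f ((if b then 1 else 0) + count (unrestrictedAfter b bs (isFree T)) m)) bss)
                                                              ≡⟨ total b ⟩
  (if b then binomialSum (f ∘ suc) (count (isFree T) m) else binomialSum⁺ f (count (isFree T) m))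
                                                              ≡⟨ cong (λ u → if b then binomialSum (f ∘ suc) u else binomialSum⁺ f u) (U-count T) ⟨
  (if b then binomialSum (f ∘ suc) (U T) else binomialSum⁺ f (U T)) ∎
  where
  open ≡-Reasoning
  m   = Filling.shiftedRows T
  bss = columnFillings b (isFree T) m

  total : ∀ b → sum (map (λ bs → f ((if b then 1 else 0) + count (unrestrictedAfter b bs (isFree T)) m))
                         (columnFillings b (isFree T) m)) ≡
          (if b then binomialSum (f ∘ suc) (count (isFree T) m) else binomialSum⁺ f (count (isFree T) m))
  -- A diagonal 1 makes the new top row free, which shifts the weight by one.
  total true  = sum-columnFillings true (f ∘ suc) (isFree T) m
  total false = sum-columnFillings false f (isFree T) m

-- The factor 2: columns with diagonal 1 give one binomial sum, and the `row` step completes the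
-- columns with diagonal 0 to another.
sum-steps : ∀ {n T} → IsTableau n T → ∀ f →
            sum (map (f ∘ U ∘ grow T) (steps T)) ≡ 2 * binomialSum (f ∘ suc) (U T)
sum-steps {T = T} t f = begin
  h row + sum (map h (columnSteps T true ++ columnSteps T false))
    ≡⟨ cong (λ xs → h row + sum xs) (map-++ h (columnSteps T true) _) ⟩
  h row + sum (map h (columnSteps T true) ++ map h (columnSteps T false))
    ≡⟨ cong (h row +_) (sum-++ (map h (columnSteps T true)) _) ⟩
  h row + (sum (map h (columnSteps T true)) + sum (map h (columnSteps T false)))
    ≡⟨ cong₂ _+_ (cong f (U-addRow t)) (cong₂ _+_ (sum-columnSteps t f true) (sum-columnSteps t f false)) ⟩
  f (suc u) + (binomialSum (f ∘ suc) u + binomialSum⁺ f u)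
    ≡⟨ rearrange (f (suc u)) (binomialSum (f ∘ suc) u) (binomialSum⁺ f u) ⟩
  binomialSum (f ∘ suc) u + (f (suc u) + binomialSum⁺ f u)
    ≡⟨ cong (binomialSum (f ∘ suc) u +_) (trans (binomialSum⁺-complement f u) (sym (+-identityʳ _))) ⟩
  2 * binomialSum (f ∘ suc) u ∎
  where
  open ≡-Reasoning
  u = U T
  h = f ∘ U ∘ grow T

  rearrange : ∀ a b c → a + (b + c) ≡ b + (a + c)
  rearrange = solve-∀

sum-𝓑-suc : ∀ n f → sum (map (f ∘ U) (𝓑 (suc n))) ≡ sum (map (λ T → 2 * binomialSum (f ∘ suc) (U T)) (𝓑 n))
sum-𝓑-suc n f = begin
  sum (map (f ∘ U) (𝓑 (suc n)))                                      ≡⟨ sum-↭ (Perm.map⁺ (f ∘ U) (𝓑-suc n)) ⟩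
  sum (map (f ∘ U) (map (uncurry grow) (pairs steps (𝓑 n))))         ≡⟨ cong sum (map-∘ (pairs steps (𝓑 n))) ⟨
  sum (map (f ∘ U ∘ uncurry grow) (pairs steps (𝓑 n)))               ≡⟨ sum-pairs steps (f ∘ U ∘ uncurry grow) (𝓑 n) ⟩
  sum (map (λ T → sum (map (f ∘ U ∘ grow T) (steps T))) (𝓑 n))       ≡⟨ sum-map-cong {xs = 𝓑 n} (λ T∈ → sum-steps (to (∈-𝓑 {n}) T∈) f) ⟩
  sum (map (λ T → 2 * binomialSum (f ∘ suc) (U T)) (𝓑 n))            ∎
  where open ≡-Reasoning

-- Generating function and its derivative

binomialSum-linear : ∀ f g x k → binomialSum (λ u → f u + x * g u) k ≡ binomialSum f k + x * binomialSum g k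
binomialSum-linear f g x zero    = refl
binomialSum-linear f g x (suc k) = trans
  (cong₂ _+_ (binomialSum-linear f g x k) (binomialSum-linear (f ∘ suc) (g ∘ suc) x k))
  (rearrange (binomialSum f k) x (binomialSum g k) (binomialSum (f ∘ suc) k) (binomialSum (g ∘ suc) k))
  where
  rearrange : ∀ a x b c d → a + x * b + (c + x * d) ≡ a + c + x * (b + d)
  rearrange = solve-∀

binomialSum-scale : ∀ f x k → binomialSum (λ u → x * f u) k ≡ x * binomialSum f k
binomialSum-scale f x zero    = refl
binomialSum-scale f x (suc k) = trans
  (cong₂ _+_ (binomialSum-scale f x k) (binomialSum-scale (f ∘ suc) x k))
  (sym (*-distribˡ-+ x (binomialSum f k) _))

-- The binomial theorem, source of the shift from x to x + 1.
binomialSum-power : ∀ x k → binomialSum (x ^_) k ≡ suc x ^ k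
binomialSum-power x zero    = refl
binomialSum-power x (suc k) = cong₂ _+_ (binomialSum-power x k)
  (trans (binomialSum-scale (x ^_) x k) (cong (x *_) (binomialSum-power x k)))

-- u x^(u-1)
powerDerivative : ℕ → ℕ → ℕ
powerDerivative x zero    = 0
powerDerivative x (suc u) = x ^ u + x * powerDerivative x u

-- The binomial theorem differentiated in x; the product rule for x·xᵘ, built into
-- `powerDerivative`, replaces the differentiation.
binomialSum-powerDerivative : ∀ x k → binomialSum (powerDerivative x) k ≡ powerDerivative (suc x) k
binomialSum-powerDerivative x zero    = refl
binomialSum-powerDerivative x (suc k) = begin
  binomialSum D k + binomialSum (λ u → x ^ u + x * D u) k
    ≡⟨ cong (binomialSum D k +_) (binomialSum-linear (x ^_) D x k) ⟩
  binomialSum D k + (binomialSum (x ^_) k + x * binomialSum D k)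
    ≡⟨ cong₂ (λ d p → d + (p + x * d)) (binomialSum-powerDerivative x k) (binomialSum-power x k) ⟩
  D′ k + (suc x ^ k + x * D′ k)
    ≡⟨ rearrange (D′ k) (suc x ^ k) x ⟩
  suc x ^ k + suc x * D′ k ∎
  where
  open ≡-Reasoning
  D = powerDerivative x
  D′ = powerDerivative (suc x)

  rearrange : ∀ d p x → d + (p + x * d) ≡ p + (1 + x) * d
  rearrange = solve-∀

powerDerivative-one : ∀ u → powerDerivative 1 u ≡ u
powerDerivative-one zero    = refl
powerDerivative-one (suc u) = cong₂ _+_ (^-zeroˡ u) (trans (+-identityʳ _) (powerDerivative-one u))

-- 2ⁿ x (x + 1) ⋯ (x + n − 1) and its derivative
generating : ℕ → ℕ → ℕ
generating zero    x = 1
generating (suc n) x = 2 * (x * generating n (suc x))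

generatingDerivative : ℕ → ℕ → ℕ
generatingDerivative zero    x = 0
generatingDerivative (suc n) x = 2 * (generating n (suc x) + x * generatingDerivative n (suc x))

sum-map-linear : {A : Set} (f g : A → ℕ) (x : ℕ) (ys : List A) →
  sum (map (λ y → 2 * (f y + x * g y)) ys) ≡ 2 * (sum (map f ys) + x * sum (map g ys))
sum-map-linear f g x []       = cong (2 *_) (sym (*-zeroʳ x))
sum-map-linear f g x (y ∷ ys) = trans (cong (2 * (f y + x * g y) +_) (sum-map-linear f g x ys))
  (rearrange (f y) x (g y) (sum (map f ys)) (sum (map g ys)))
  where
  rearrange : ∀ a x b c d → 2 * (a + x * b) + 2 * (c + x * d) ≡ 2 * (a + c + x * (b + d))
  rearrange = solve-∀

sum-map-scale : {A : Set} (g : A → ℕ) (x : ℕ) (ys : List A) →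
  sum (map (λ y → x * g y) ys) ≡ x * sum (map g ys)
sum-map-scale g x []       = sym (*-zeroʳ x)
sum-map-scale g x (y ∷ ys) = trans (cong (x * g y +_) (sum-map-scale g x ys)) (sym (*-distribˡ-+ x (g y) _))

sum-power-U : ∀ n x → sum (map (λ T → x ^ U T) (𝓑 n)) ≡ generating n x
-- By evaluation: `𝓑 0` contains only the filling without rows and columns, whose weight is x⁰.
sum-power-U zero    x = refl
sum-power-U (suc n) x = begin
  sum (map (λ T → x ^ U T) (𝓑 (suc n)))                        ≡⟨ sum-𝓑-suc n (x ^_) ⟩
  sum (map (λ T → 2 * binomialSum (λ u → x * x ^ u) (U T)) (𝓑 n))
    ≡⟨ sum-map-cong {xs = 𝓑 n} (λ {T} _ → cong (2 *_) (trans (binomialSum-scale (x ^_) x (U T)) (cong (x *_) (binomialSum-power x (U T))))) ⟩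
  sum (map (λ T → 2 * (x * suc x ^ U T)) (𝓑 n))
    ≡⟨ sum-map-scale (λ T → x * suc x ^ U T) 2 (𝓑 n) ⟩
  2 * sum (map (λ T → x * suc x ^ U T) (𝓑 n))
    ≡⟨ cong (2 *_) (sum-map-scale (λ T → suc x ^ U T) x (𝓑 n)) ⟩
  2 * (x * sum (map (λ T → suc x ^ U T) (𝓑 n)))
    ≡⟨ cong (λ k → 2 * (x * k)) (sum-power-U n (suc x)) ⟩
  generating (suc n) x ∎
  where open ≡-Reasoning

sum-powerDerivative-U : ∀ n x → sum (map (λ T → powerDerivative x (U T)) (𝓑 n)) ≡ generatingDerivative n x
sum-powerDerivative-U zero    x = refl
sum-powerDerivative-U (suc n) x = begin
  sum (map (λ T → powerDerivative x (U T)) (𝓑 (suc n)))        ≡⟨ sum-𝓑-suc n (powerDerivative x) ⟩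
  sum (map (λ T → 2 * binomialSum (λ u → x ^ u + x * powerDerivative x u) (U T)) (𝓑 n))
    ≡⟨ sum-map-cong {xs = 𝓑 n} (λ {T} _ → cong (2 *_) (trans (binomialSum-linear (x ^_) (powerDerivative x) x (U T))
         (cong₂ (λ p d → p + x * d) (binomialSum-power x (U T)) (binomialSum-powerDerivative x (U T))))) ⟩
  sum (map (λ T → 2 * (suc x ^ U T + x * powerDerivative (suc x) (U T))) (𝓑 n))
    ≡⟨ sum-map-linear (λ T → suc x ^ U T) (λ T → powerDerivative (suc x) (U T)) x (𝓑 n) ⟩
  2 * (sum (map (λ T → suc x ^ U T) (𝓑 n)) + x * sum (map (λ T → powerDerivative (suc x) (U T)) (𝓑 n)))
    ≡⟨ cong₂ (λ p d → 2 * (p + x * d)) (sum-power-U n (suc x)) (sum-powerDerivative-U n (suc x)) ⟩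
  generatingDerivative (suc n) x ∎
  where open ≡-Reasoning

length-𝓑 : ∀ n → length (𝓑 n) ≡ generating n 1
length-𝓑 n = trans (ones (𝓑 n)) (sum-power-U n 1)
  where
  ones : ∀ Ts → length Ts ≡ sum (map (λ T → 1 ^ U T) Ts)
  ones []       = refl
  ones (T ∷ Ts) = cong₂ _+_ (sym (^-zeroˡ (U T))) (ones Ts)

sum-U : ∀ n → sum (map U (𝓑 n)) ≡ generatingDerivative n 1
sum-U n = trans (sum-map-cong {xs = 𝓑 n} (λ {T} _ → sym (powerDerivative-one (U T)))) (sum-powerDerivative-U n 1)

-- Rational arithmetic

-- Among unnormalised fractions no common divisors are cancelled, so the laws below become integer
-- identities.
toℚᵘ-ℕ→ℚ : ∀ k → toℚᵘ (ℕ→ℚ k) ℚᵘ.≃ mkℚᵘ (ℤ.+ k) 0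
toℚᵘ-ℕ→ℚ k = ℚ.toℚᵘ-fromℚᵘ (mkℚᵘ (ℤ.+ k) 0)

ℕ→ℚ-+ : ∀ a b → ℕ→ℚ (a + b) ≡ ℕ→ℚ a ℚ.+ ℕ→ℚ b
ℕ→ℚ-+ a b = ℚ.toℚᵘ-injective (begin
  toℚᵘ (ℕ→ℚ (a + b))                          ≈⟨ toℚᵘ-ℕ→ℚ (a + b) ⟩
  mkℚᵘ (ℤ.+ (a + b)) 0                        ≡⟨ cong (λ z → mkℚᵘ z 0) (cong₂ ℤ._+_ (sym (ℤ.*-identityʳ (ℤ.+ a))) (sym (ℤ.*-identityʳ (ℤ.+ b)))) ⟩
  mkℚᵘ (ℤ.+ a) 0 ℚᵘ.+ mkℚᵘ (ℤ.+ b) 0          ≈⟨ ℚᵘ.+-cong (toℚᵘ-ℕ→ℚ a) (toℚᵘ-ℕ→ℚ b) ⟨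
  toℚᵘ (ℕ→ℚ a) ℚᵘ.+ toℚᵘ (ℕ→ℚ b)              ≈⟨ ℚ.toℚᵘ-homo-+ (ℕ→ℚ a) (ℕ→ℚ b) ⟨
  toℚᵘ (ℕ→ℚ a ℚ.+ ℕ→ℚ b)                      ∎)
  where open ℚᵘ.≃-Reasoning

ℕ→ℚ-* : ∀ a b → ℕ→ℚ (a * b) ≡ ℕ→ℚ a ℚ.* ℕ→ℚ b
ℕ→ℚ-* a b = ℚ.toℚᵘ-injective (begin
  toℚᵘ (ℕ→ℚ (a * b))                          ≈⟨ toℚᵘ-ℕ→ℚ (a * b) ⟩
  mkℚᵘ (ℤ.+ (a * b)) 0                        ≡⟨ cong (λ z → mkℚᵘ z 0) (ℤ.pos-* a b) ⟩
  mkℚᵘ (ℤ.+ a) 0 ℚᵘ.* mkℚᵘ (ℤ.+ b) 0          ≈⟨ ℚᵘ.*-cong (toℚᵘ-ℕ→ℚ a) (toℚᵘ-ℕ→ℚ b) ⟨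
  toℚᵘ (ℕ→ℚ a) ℚᵘ.* toℚᵘ (ℕ→ℚ b)              ≈⟨ ℚ.toℚᵘ-homo-* (ℕ→ℚ a) (ℕ→ℚ b) ⟨
  toℚᵘ (ℕ→ℚ a ℚ.* ℕ→ℚ b)                      ∎)
  where open ℚᵘ.≃-Reasoning

ℕ→ℚ-inverse : ∀ k .{{_ : NonZero k}} → ℕ→ℚ k ℚ.* (ℤ.+ 1 / k) ≡ 1ℚ
ℕ→ℚ-inverse (suc k) = ℚ.toℚᵘ-injective (begin
  toℚᵘ (ℕ→ℚ (suc k) ℚ.* (ℤ.+ 1 / suc k))             ≈⟨ ℚ.toℚᵘ-homo-* (ℕ→ℚ (suc k)) (ℤ.+ 1 / suc k) ⟩
  toℚᵘ (ℕ→ℚ (suc k)) ℚᵘ.* toℚᵘ (ℤ.+ 1 / suc k)       ≈⟨ ℚᵘ.*-cong (toℚᵘ-ℕ→ℚ (suc k)) (ℚ.toℚᵘ-fromℚᵘ (mkℚᵘ (ℤ.+ 1) k)) ⟩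
  mkℚᵘ (ℤ.+ suc k) 0 ℚᵘ.* mkℚᵘ (ℤ.+ 1) k             ≈⟨ *≡* (cong ℤ.+_ (rearrange k)) ⟩
  ℚᵘ.1ℚᵘ                                             ∎)
  where
  open ℚᵘ.≃-Reasoning
  rearrange : ∀ k → suc k * 1 * 1 ≡ 1 * (1 * suc k)
  rearrange = solve-∀

sumℚ-scale : {A : Set} (g : A → ℕ) (p : ℚ) (xs : List A) →
             sumℚ (map (λ x → ℕ→ℚ (g x) ℚ.* p) xs) ≡ ℕ→ℚ (sum (map g xs)) ℚ.* p
sumℚ-scale g p []       = sym (ℚ.*-zeroˡ p)
sumℚ-scale g p (x ∷ xs) = begin
  ℕ→ℚ (g x) ℚ.* p ℚ.+ sumℚ (map (λ x → ℕ→ℚ (g x) ℚ.* p) xs) ≡⟨ cong (ℕ→ℚ (g x) ℚ.* p ℚ.+_) (sumℚ-scale g p xs) ⟩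
  ℕ→ℚ (g x) ℚ.* p ℚ.+ ℕ→ℚ (sum (map g xs)) ℚ.* p            ≡⟨ ℚ.*-distribʳ-+ p (ℕ→ℚ (g x)) _ ⟨
  (ℕ→ℚ (g x) ℚ.+ ℕ→ℚ (sum (map g xs))) ℚ.* p                ≡⟨ cong (ℚ._* p) (ℕ→ℚ-+ (g x) _) ⟨
  ℕ→ℚ (g x + sum (map g xs)) ℚ.* p                          ∎
  where open ≡-Reasoning

-- The sum 1/(x + 1) + ⋯ + 1/(x + n); the free starting point lets the induction follow the shift of
-- x.
harmonicFrom : ℕ → ℕ → ℚ
harmonicFrom x zero    = 0ℚ
harmonicFrom x (suc n) = (ℤ.+ 1 / suc x) ℚ.+ harmonicFrom (suc x) n

H-harmonicFrom : ∀ n → H n ≡ harmonicFrom 0 n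
H-harmonicFrom n = shifted n 0 id (λ _ → refl)
  where
  shifted : ∀ n x (g : ℕ → ℕ) → (∀ k → g k ≡ x + k) →
            sumℚ (map (λ k → ℤ.+ 1 / suc k) (applyUpTo g n)) ≡ harmonicFrom x n
  shifted zero    x g eq = refl
  shifted (suc n) x g eq = cong₂ (λ k q → (ℤ.+ 1 / suc k) ℚ.+ q) (trans (eq 0) (+-identityʳ x))
    (shifted n (suc x) (g ∘ suc) (λ k → trans (eq (suc k)) (+-suc x k)))

-- The logarithmic derivative of 2ⁿ y(y + 1)⋯(y + n - 1) is Σ 1/(y + j), here multiplied out and
-- taken at y = x + 1, where no denominator vanishes.
generatingDerivative-harmonic : ∀ n x →
  ℕ→ℚ (generatingDerivative n (suc x)) ≡ ℕ→ℚ (generating n (suc x)) ℚ.* harmonicFrom x n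
generatingDerivative-harmonic zero    x = sym (ℚ.*-zeroʳ 1ℚ)
generatingDerivative-harmonic (suc n) x = begin
  ℕ→ℚ (2 * (G + suc x * G′))                     ≡⟨ ℕ→ℚ-* 2 (G + suc x * G′) ⟩
  two ℚ.* ℕ→ℚ (G + suc x * G′)                   ≡⟨ cong (two ℚ.*_) (trans (ℕ→ℚ-+ G _) (cong (g ℚ.+_) (ℕ→ℚ-* (suc x) G′))) ⟩
  two ℚ.* (g ℚ.+ y ℚ.* ℕ→ℚ G′)                   ≡⟨ cong₂ (λ a b → two ℚ.* (a ℚ.+ y ℚ.* b)) (sym (ℚ.*-identityʳ g)) (generatingDerivative-harmonic n (suc x)) ⟩
  -- Writing 1 as y·(1/y) lets y·g be factored out, and 1/y becomes the new first term of the
  -- harmonic sum.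
  two ℚ.* (g ℚ.* 1ℚ ℚ.+ y ℚ.* (g ℚ.* h))         ≡⟨ cong (λ a → two ℚ.* (g ℚ.* a ℚ.+ y ℚ.* (g ℚ.* h))) (sym (ℕ→ℚ-inverse (suc x))) ⟩
  two ℚ.* (g ℚ.* (y ℚ.* z) ℚ.+ y ℚ.* (g ℚ.* h))  ≡⟨ solve 5 (λ t g y z h → t :* (g :* (y :* z) :+ y :* (g :* h)) := t :* (y :* g) :* (z :+ h)) refl two g y z h ⟩
  two ℚ.* (y ℚ.* g) ℚ.* (z ℚ.+ h)                ≡⟨ cong (ℚ._* (z ℚ.+ h)) (trans (ℕ→ℚ-* 2 (suc x * G)) (cong (two ℚ.*_) (ℕ→ℚ-* (suc x) G))) ⟨
  ℕ→ℚ (2 * (suc x * G)) ℚ.* (z ℚ.+ h)            ∎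
  where
  open ≡-Reasoning
  open +-*-Solver
  G  = generating n (2 + x)
  G′ = generatingDerivative n (2 + x)
  two = ℕ→ℚ 2
  g  = ℕ→ℚ G
  y  = ℕ→ℚ (suc x)
  z  = ℤ.+ 1 / suc x
  h  = harmonicFrom (suc x) n

mainTheorem5 : ∀ (n : ℕ) → 1 ≤ n → 𝔼 n (λ T → ℕ→ℚ (U T)) ≡ H n
mainTheorem5 n _ = begin
  𝔼 n (λ T → ℕ→ℚ (U T))                          ≡⟨ sumℚ-scale U (ℙ n) (𝓑 n) ⟩
  ℕ→ℚ (sum (map U (𝓑 n))) ℚ.* ℙ n                ≡⟨ cong (λ k → ℕ→ℚ k ℚ.* ℙ n) (sum-U n) ⟩
  ℕ→ℚ (generatingDerivative n 1) ℚ.* ℙ n         ≡⟨ cong (ℚ._* ℙ n) (generatingDerivative-harmonic n 0) ⟩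
  ℕ→ℚ (generating n 1) ℚ.* harmonicFrom 0 n ℚ.* ℙ n
    -- At x = 1 the generating function counts the tableaux, so it cancels against `ℙ n`.
    ≡⟨ cong₂ (λ k h → ℕ→ℚ k ℚ.* h ℚ.* ℙ n) (length-𝓑 n) (H-harmonicFrom n) ⟨
  N ℚ.* H n ℚ.* ℙ n                              ≡⟨ solve 3 (λ N h p → N :* h :* p := h :* (N :* p)) refl N (H n) (ℙ n) ⟩
  H n ℚ.* (N ℚ.* ℙ n)                            ≡⟨ cong (H n ℚ.*_) (ℕ→ℚ-inverse (length (𝓑 n)) {{𝓑-nonZero n}}) ⟩
  H n ℚ.* 1ℚ                                     ≡⟨ ℚ.*-identityʳ (H n) ⟩
  H n                                            ∎
  where
  open ≡-Reasoning
  open +-*-Solver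
  N = ℕ→ℚ (length (𝓑 n))
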